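{- There is no deterministic sequential algorithm that outputs the correct answer for every instance $(D,\ell,0)$ of Directed Component Order Connectivity in which $D$ is a tournament and runs in time $o(n^2)$, where $n=|V(D)|$.
   Context: A tournament is a digraph (finite, without loops or parallel arcs) in which there is exactly one arc between every pair of distinct vertices. For a digraph $H$, $\mathrm{mco}(H)$ denotes the number of vertices in a largest strongly connected component of $H$. Directed Component Order Connectivity (DCOC) is the following decision problem. Input: a digraph $D=(V,A)$ with $n=|V|$ and integers $\ell\ge 1$, $k\ge 0$. Question: is there a set $X\subseteq V$ of size $k$ such that $\mathrm{mco}(D-X)\le \ell$? Thus for $k=0$ the question is whether $\mathrm{mco}(D)\le \ell$. Standing convention: $k+\ell<n$. The bound is unconditional and concerns reading the input: the algorithm learns the orientation of the arc between a pair of vertices by reading that arc of the input, each arc read costing at least one step. -}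

module Defs where

open import Data.Bool.Base using (Bool; true; false; T; _xor_)
open import Data.Fin.Base using (Fin; zero; suc)
open import Data.Fin.Subset using (Subset; inside; outside; _∈_; ∁; ∣_∣)
open import Data.Nat.Base using (ℕ; zero; suc; _+_; _*_; _≤_; _<_; _≥_)
open import Data.Product.Base using (_×_; ∃-syntax)
open import Data.Vec.Base using (_∷_)
open import Function.Bundles using (_⇔_)
open import Relation.Binary.Construct.Closure.ReflexiveTransitive using (Star)
open import Relation.Binary.PropositionalEquality using (_≡_; _≢_)

-- Digraphs with vertex set Fin n.  The Boolean adjacency function rules out
-- parallel arcs; opposite arcs are allowed.
record Digraph (n : ℕ) : Set where
  field
    arc      : Fin n → Fin n → Bool
    loopless : ∀ v → arc v v ≡ false

open Digraph public

Arc : ∀ {n} → Digraph n → Fin n → Fin n → Set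
Arc D u v = T (arc D u v)

Tournament : ∀ {n} → Digraph n → Set
Tournament D = ∀ u v → u ≢ v → T (arc D u v xor arc D v u)

Reachable : ∀ {n} → Digraph n → Fin n → Fin n → Set
Reachable D = Star (Arc D)

-- Strong components are the classes of mutual reachability.
IsStrongComponent : ∀ {n} → Digraph n → Subset n → Set
IsStrongComponent D C =
  ∃[ v ] (∀ u → u ∈ C ⇔ (Reachable D v u × Reachable D u v))

-- IsMco D m says mco(D) = m.  It is a relation, with no value for the digraph
-- without vertices; D − X always has a vertex when k + ℓ < n.
IsMco : ∀ {n} → Digraph n → ℕ → Set
IsMco D m =
  (∃[ C ] IsStrongComponent D C × ∣ C ∣ ≡ m) ×
  (∀ C → IsStrongComponent D C → ∣ C ∣ ≤ m)

-- The increasing enumeration of the elements of S.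
element : ∀ {n} (S : Subset n) → Fin ∣ S ∣ → Fin n
element (inside  ∷ S) zero    = zero
element (inside  ∷ S) (suc i) = suc (element S i)
element (outside ∷ S) i       = suc (element S i)

-- Vertex deletion: the vertices outside X, renumbered in increasing order.
infixl 6 _−_
_−_ : ∀ {n} → Digraph n → (X : Subset n) → Digraph ∣ ∁ X ∣
D − X = record
  { arc      = λ u v → arc D (element (∁ X) u) (element (∁ X) v)
  ; loopless = λ v → loopless D (element (∁ X) v)
  }

DCOC : ∀ {n} → Digraph n → (ℓ k : ℕ) → Set
DCOC D ℓ k = ∃[ X ] ∣ X ∣ ≡ k × (∃[ m ] IsMco (D − X) m × m ≤ ℓ)

Admissible : (n ℓ k : ℕ) → Set
Admissible n ℓ k = 1 ≤ ℓ × k + ℓ < n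

-- One step of a sequential algorithm: halt with an answer, move to another
-- state without consulting the digraph, or read one entry of the adjacency
-- function (on a tournament: the orientation of one arc) and continue
-- accordingly.
data Action (n : ℕ) (S : Set) : Set where
  output  : Bool → Action n S
  compute : S → Action n S
  read    : (u v : Fin n) → (Bool → S) → Action n S

-- Deterministic sequential algorithms as arbitrary transition systems, possibly
-- infinite and non-computable; any concrete machine model in which a step reads
-- at most one entry of the input digraph is an instance.  The numbers n, ℓ and k
-- are known from the start, while D is accessible only through read.
record Algorithm : Set₁ where
  field
    State : ℕ → Set
    start : (n ℓ k : ℕ) → State n
    step  : ∀ {n} → State n → Action n (State n)

module _ (𝒜 : Algorithm) where
  open Algorithm 𝒜

  -- RunsTo D s b t: on input digraph D, started in state s, the algorithm
  -- outputs b after exactly t read or compute steps.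
  data RunsTo {n} (D : Digraph n) (s : State n) (b : Bool) : ℕ → Set where
    halted   : step s ≡ output b → RunsTo D s b 0
    computed : ∀ {s′ t} → step s ≡ compute s′ →
               RunsTo D s′ b t → RunsTo D s b (suc t)
    answered : ∀ {u v next t} → step s ≡ read u v next →
               RunsTo D (next (arc D u v)) b t → RunsTo D s b (suc t)

  Outputs : ∀ {n} → Digraph n → (ℓ k : ℕ) → Bool → ℕ → Set
  Outputs {n} D ℓ k b t = RunsTo D (start n ℓ k) b t

  CorrectOn : ∀ {n} → Digraph n → (ℓ k : ℕ) → Set
  CorrectOn D ℓ k =
    ∃[ b ] ∃[ t ] Outputs D ℓ k b t × (b ≡ true ⇔ DCOC D ℓ k)

  TimeAtMost : ∀ {n} → ℕ → Digraph n → (ℓ k : ℕ) → Set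
  TimeAtMost τ D ℓ k = ∀ b t → Outputs D ℓ k b t → t ≤ τ

-- f = o(g), with ε ranging over the reciprocals 1/c.
_∈o_ : (ℕ → ℕ) → (ℕ → ℕ) → Set
f ∈o g = ∀ c → ∃[ n₀ ] (∀ n → n ≥ n₀ → c * f n ≤ g n)

{-# OPTIONS --safe #-}
-- The transitive tournament has mco = 1, so for ℓ = 1 the answer is yes.
-- Reversing the arc from a to b, where a < c < b for some c, creates the cycle
-- a → c → b → a, and the answer becomes no.  A run on the transitive tournament
-- that does not read the arc between a and b is also a run on the tournament
-- with this arc reversed, so a correct algorithm reads all such arcs.  With
-- n = 2m + 1 vertices, m² of these arcs pass over the middle vertex.
module Submission where

open import Defs
open import Data.Bool.Base using (Bool; true; false; _∧_; _∨_; if_then_else_)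
open import Data.Bool.Properties using (∧-comm; ∨-comm) renaming (_≟_ to _≟ᵇ_)
open import Data.Empty using (⊥-elim)
open import Data.Fin.Base as Fin using (Fin; zero; suc; toℕ; _↑ˡ_; _↑ʳ_; combine; remQuot)
open import Data.Fin.Properties as Fin using (_≟_; _<?_)
open import Data.Fin.Subset using (Subset; inside; outside; _∈_; _∉_; ∁; ∣_∣; ⊥; ⁅_⁆)
open import Data.Fin.Subset.Properties
  using (x∈⁅x⁆; x∈⁅y⁆⇒x≡y; ∣⁅x⁆∣≡1; ∣⊥∣≡0; p⊆q⇒∣p∣≤∣q∣; x∈p⇒∣p-x∣<∣p∣;
         x∈p∧x≢y⇒x∈p-y; x∉p⇒x∈∁p; drop-there)
open import Data.List.Base using (List; []; _∷_; length; lookup)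
open import Data.List.Relation.Unary.Any as Any using (Any; here; there)
open import Data.List.Relation.Unary.Any.Properties using (lookup-index)
open import Data.Nat.Base using (ℕ; zero; suc; _+_; _*_; _^_; _≤_; _<_; z≤n; s≤s; z<s)
open import Data.Nat.Properties
  using (≤-refl; ≤-reflexive; ≤-trans; <-≤-trans; m≤n⇒m≤1+n; m≤n+m; m≤m+n;
         m<m+n; <⇒≤; <⇒≱; <⇒<ᵇ; <ᵇ⇒<; +-monoʳ-<; *-monoʳ-≤; module ≤-Reasoning)
open import Data.Nat.Tactic.RingSolver using (solve-∀)
open import Data.Product.Base using (Σ-syntax; ∃-syntax; _×_; _,_; proj₁; proj₂)
open import Data.Sum.Base using (_⊎_; inj₁; inj₂)
open import Data.Vec.Base using (_∷_; []; here; there)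
open import Function.Base using (_∘_; id)
open import Function.Bundles using (_⇔_; mk⇔; Equivalence)
open import Relation.Binary.Construct.Closure.ReflexiveTransitive using (ε; _◅_; fold; gmap)
open import Relation.Binary.Definitions using (tri<; tri≈; tri>)
open import Relation.Binary.PropositionalEquality
  using (_≡_; _≢_; refl; sym; trans; cong; cong₂; subst; subst₂)
open import Relation.Nullary.Decidable.Core using (yes; no; does)
open import Relation.Nullary.Decidable using (dec-true; dec-false)
open import Relation.Nullary.Negation.Core using (¬_; contradiction)

open Equivalence using (to; from)

-- Finite subsets: small cardinalities and comprehension

∣p∣≤1⇒x≡y : ∀ {n} {p : Subset n} {x y} → ∣ p ∣ ≤ 1 → x ∈ p → y ∈ p → x ≡ y
∣p∣≤1⇒x≡y {p = p} {x} {y} ∣p∣≤1 x∈p y∈p with y ≟ x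
... | yes y≡x = sym y≡x
... | no  y≢x = contradiction ∣p∣≤1 (<⇒≱ (≤-trans (s≤s (≤-trans (s≤s z≤n)
                  (x∈p⇒∣p-x∣<∣p∣ (x∈p∧x≢y⇒x∈p-y y∈p y≢x)))) (x∈p⇒∣p-x∣<∣p∣ x∈p)))

∣p∣≡0⇒x∉p : ∀ {n} {p : Subset n} {x} → ∣ p ∣ ≡ 0 → x ∉ p
∣p∣≡0⇒x∉p ∣p∣≡0 x∈p with () ← ≤-trans (x∈p⇒∣p-x∣<∣p∣ x∈p) (≤-reflexive ∣p∣≡0)

-- Reachability is not decided here; that the subset exists up to double
-- negation is enough for refuting IsMco.
¬¬-comprehension : ∀ {n} (P : Fin n → Set) →
                   ¬ ¬ (Σ[ C ∈ Subset n ] (∀ u → u ∈ C ⇔ P u))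
¬¬-comprehension {zero}  P ¬C = ¬C ([] , λ ())
¬¬-comprehension {suc n} P ¬C = ¬¬-comprehension (P ∘ suc) λ (C , C⇔P) →
  let extend : ∀ {s u} → u ∈ C ⇔ P (suc u) → suc u ∈ s ∷ C ⇔ P (suc u)
      extend e = mk⇔ (to e ∘ drop-there) (there ∘ from e)
      ¬P₀ : ¬ P zero
      ¬P₀ p = ¬C (inside ∷ C , λ { zero    → mk⇔ (λ _ → p) (λ _ → here)
                                 ; (suc u) → extend (C⇔P u) })
  in ¬C (outside ∷ C , λ { zero    → mk⇔ (λ ()) (⊥-elim ∘ ¬P₀)
                         ; (suc u) → extend (C⇔P u) })

-- Vertex deletion, acyclicity and mco

element-injective : ∀ {n} (S : Subset n) {i j} → element S i ≡ element S j → i ≡ j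
element-injective (inside  ∷ S) {zero}  {zero}  eq = refl
element-injective (inside  ∷ S) {suc i} {suc j} eq =
  cong suc (element-injective S (Fin.suc-injective eq))
element-injective (outside ∷ S) eq = element-injective S (Fin.suc-injective eq)

element-surjective : ∀ {n} (S : Subset n) {v} → v ∈ S → ∃[ i ] element S i ≡ v
element-surjective (inside  ∷ S) here        = zero , refl
element-surjective (inside  ∷ S) (there v∈S) =
  let i , eq = element-surjective S v∈S in suc i , cong suc eq
element-surjective (outside ∷ S) (there v∈S) =
  let i , eq = element-surjective S v∈S in i , cong suc eq

Acyclic : ∀ {n} → Digraph n → Set
Acyclic D = ∀ {u v} → Reachable D u v → Reachable D v u → u ≡ v

acyclic-− : ∀ {n} {D : Digraph n} → Acyclic D → ∀ X → Acyclic (D − X)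
acyclic-− acyclic X u⇝v v⇝u = element-injective (∁ X)
  (acyclic (gmap (element (∁ X)) id u⇝v) (gmap (element (∁ X)) id v⇝u))

acyclic⇒mco≡1 : ∀ {n} {D : Digraph n} → Fin n → Acyclic D → IsMco D 1
acyclic⇒mco≡1 {D = D} r acyclic =
  (⁅ r ⁆ , (r , λ u → mk⇔
    (λ u∈ → subst (λ w → Reachable D r w × Reachable D w r)
                  (sym (x∈⁅y⁆⇒x≡y r u∈)) (ε , ε))
    (λ (r⇝u , u⇝r) → subst (_∈ ⁅ r ⁆) (acyclic r⇝u u⇝r) (x∈⁅x⁆ r)))
  , ∣⁅x⁆∣≡1 r) ,
  λ C (v , C⇔) → ≤-trans
    (p⊆q⇒∣p∣≤∣q∣ λ {u} u∈C → let v⇝u , u⇝v = to (C⇔ u) u∈C in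
      subst (_∈ ⁅ v ⁆) (acyclic v⇝u u⇝v) (x∈⁅x⁆ v))
    (≤-reflexive (∣⁅x⁆∣≡1 v))

acyclic⇒DCOC : ∀ {n} {D : Digraph n} → Fin n → Acyclic D → DCOC D 1 0
-- The vertex excludes the empty digraph, where `IsMco` has no value. After the match on `suc n`,
-- the size of `∁ ⊥` reduces to a successor, so `zero` is a vertex of `D − ⊥`.
acyclic⇒DCOC {suc n} {D} _ acyclic =
  ⊥ , ∣⊥∣≡0 (suc n) , 1 ,
  acyclic⇒mco≡1 {D = D − ⊥} zero (acyclic-− {D = D} acyclic ⊥) , ≤-refl

-- The strong component of `u` would contain both `u` and `v`. Since equality on `Fin` is decidable,
-- only a contradiction has to be derived, and for that its existence up to double negation is
-- enough.
mco≤1⇒acyclic : ∀ {n} {D : Digraph n} {m} → IsMco D m → m ≤ 1 → Acyclic D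
mco≤1⇒acyclic {D = D} (_ , max) m≤1 {u} {v} u⇝v v⇝u with u ≟ v
... | yes u≡v = u≡v
... | no  u≢v = ⊥-elim (¬¬-comprehension (λ w → Reachable D u w × Reachable D w u)
  λ (C , C⇔) → u≢v (∣p∣≤1⇒x≡y (≤-trans (max C (u , C⇔)) m≤1)
                              (from (C⇔ u) (ε , ε)) (from (C⇔ v) (u⇝v , v⇝u))))

3-cycle⇒¬DCOC : ∀ {n} {D : Digraph n} {a b c} → Arc D a c → Arc D c b → Arc D b a →
                a ≢ b → ¬ DCOC D 1 0
3-cycle⇒¬DCOC {D = D} {a} {b} {c} ac cb ba a≢b (X , ∣X∣≡0 , m , mco , m≤1)
  -- `X` is empty, so all three vertices survive; they are replaced by their new numbers in `D − X`,
  -- where the cycle persists.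
  with a′ , refl ← element-surjective (∁ X) {a} (x∉p⇒x∈∁p (∣p∣≡0⇒x∉p ∣X∣≡0))
     | b′ , refl ← element-surjective (∁ X) {b} (x∉p⇒x∈∁p (∣p∣≡0⇒x∉p ∣X∣≡0))
     | c′ , refl ← element-surjective (∁ X) {c} (x∉p⇒x∈∁p (∣p∣≡0⇒x∉p ∣X∣≡0))
  = a≢b (cong (element (∁ X)) (mco≤1⇒acyclic {D = D − X} mco m≤1
      (_◅_ {j = c′} ac (cb ◅ ε)) (ba ◅ ε)))

-- The transitive tournament

transitive : ∀ n → Digraph n
transitive n = record
  { arc      = λ u v → does (u <? v)
  ; loopless = λ v → dec-false (v <? v) (Fin.<-irrefl refl)
  }

transitive-tournament : ∀ n → Tournament (transitive n)
transitive-tournament n u v u≢v with Fin.<-cmp u v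
... | tri≈ _ u≡v _ = contradiction u≡v u≢v
... | tri< u<v _ u≯v
  rewrite dec-true (u <? v) u<v | dec-false (v <? u) u≯v = _
... | tri> u≮v _ u>v
  rewrite dec-false (u <? v) u≮v | dec-true (v <? u) u>v = _

transitive-acyclic : ∀ n → Acyclic (transitive n)
transitive-acyclic n u⇝v v⇝u = Fin.≤-antisym (reach⇒≤ u⇝v) (reach⇒≤ v⇝u)
  where
  reach⇒≤ : ∀ {u v} → Reachable (transitive n) u v → u Fin.≤ v
  reach⇒≤ = fold Fin._≤_
    (λ {u} {v} uv v≤w → Fin.≤-trans (<⇒≤ (<ᵇ⇒< (toℕ u) (toℕ v) uv)) v≤w) Fin.≤-refl

-- Reversing a single arc

joins : ∀ {n} (a b u v : Fin n) → Bool
joins a b u v = does (u ≟ a) ∧ does (v ≟ b) ∨ does (u ≟ b) ∧ does (v ≟ a)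

Joins : ∀ {n} (a b u v : Fin n) → Set
Joins a b u v = (u ≡ a × v ≡ b) ⊎ (u ≡ b × v ≡ a)

joins⇒Joins : ∀ {n} (a b u v : Fin n) → joins a b u v ≡ true → Joins a b u v
joins⇒Joins a b u v eq with u ≟ a | v ≟ b | u ≟ b | v ≟ a
... | yes p | yes q | _     | _     = inj₁ (p , q)
... | yes _ | no  _ | yes p | yes q = inj₂ (p , q)
... | no  _ | _     | yes p | yes q = inj₂ (p , q)
joins⇒Joins a b u v () | yes _ | no _ | yes _ | no _
joins⇒Joins a b u v () | yes _ | no _ | no _  | _
joins⇒Joins a b u v () | no _  | _    | yes _ | no _
joins⇒Joins a b u v () | no _  | _    | no _  | _

joins-sym : ∀ {n} (a b u v : Fin n) → joins a b u v ≡ joins a b v u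
joins-sym a b u v = trans (∨-comm (does (u ≟ a) ∧ does (v ≟ b)) _)
  (cong₂ _∨_ (∧-comm (does (u ≟ b)) _) (∧-comm (does (u ≟ a)) _))

-- Swapping the arguments, rather than negating the answer, creates no loop even when `a` equals
-- `b`, so `a ≢ b` need not be assumed here.
reverse : ∀ {n} → Digraph n → (a b : Fin n) → Digraph n
reverse D a b = record
  { arc      = λ u v → if joins a b u v then arc D v u else arc D u v
  ; loopless = λ v → loopless-if (joins a b v v) v
  }
  where
  loopless-if : ∀ c v → (if c then arc D v v else arc D v v) ≡ false
  loopless-if true  v = loopless D v
  loopless-if false v = loopless D v

reverse-tournament : ∀ {n} {D : Digraph n} → Tournament D →
                     ∀ a b → Tournament (reverse D a b)
-- By symmetry one test governs both orders of `u` and `v`, so the goal becomes `tour` for one of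
-- the two orders.
reverse-tournament tour a b u v u≢v rewrite joins-sym a b v u with joins a b u v
... | true  = tour v u (u≢v ∘ sym)
... | false = tour u v u≢v

reverse-differs : ∀ {n} (D : Digraph n) {a b u v} →
                  arc D u v ≢ arc (reverse D a b) u v → Joins a b u v
reverse-differs D {a} {b} {u} {v} differ with joins a b u v in eq
... | true  = joins⇒Joins a b u v eq
... | false = contradiction refl differ

reverse-other : ∀ {n} (D : Digraph n) {a b u v} → ¬ Joins a b u v →
                Arc D u v → Arc (reverse D a b) u v
reverse-other D {a} {b} {u} {v} ¬joins uv with joins a b u v in eq
... | true  = contradiction (joins⇒Joins a b u v eq) ¬joins
... | false = uv

reverse-arc : ∀ {n} (D : Digraph n) {a b} → a ≢ b → Arc D a b → Arc (reverse D a b) b a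
reverse-arc D {a} {b} a≢b ab
  rewrite dec-true (a ≟ a) refl | dec-true (b ≟ b) refl | dec-false (b ≟ a) (a≢b ∘ sym) = ab

reverse-transitive-¬DCOC : ∀ {n} {a b c : Fin n} → a Fin.< c → c Fin.< b →
                           ¬ DCOC (reverse (transitive n) a b) 1 0
reverse-transitive-¬DCOC {n} {a} {b} {c} a<c c<b = 3-cycle⇒¬DCOC {D = reverse D a b}
  (reverse-other D (λ { (inj₁ (_ , c≡b)) → c≢b c≡b ; (inj₂ (a≡b , _)) → a≢b a≡b })
    (<⇒<ᵇ a<c))
  (reverse-other D (λ { (inj₁ (c≡a , _)) → a≢c (sym c≡a) ; (inj₂ (c≡b , _)) → c≢b c≡b })
    (<⇒<ᵇ c<b))
  (reverse-arc D a≢b (<⇒<ᵇ (Fin.<-trans a<c c<b)))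
  a≢b
  where
  D = transitive n
  a≢c = Fin.<⇒≢ a<c
  c≢b = Fin.<⇒≢ c<b
  a≢b = Fin.<⇒≢ (Fin.<-trans a<c c<b)

Distinguishes : ∀ {n} (D D′ : Digraph n) → Fin n × Fin n → Set
Distinguishes D D′ (u , v) = arc D u v ≢ arc D′ u v

-- Pairs of vertices on opposite sides of the middle one

module _ {m : ℕ} where
  left right : Fin m → Fin (m + suc m)
  left  i = i ↑ˡ suc m
  right i = m ↑ʳ suc i

  middle : Fin (m + suc m)
  middle = m ↑ʳ zero

  left<middle : ∀ i → left i Fin.< middle
  left<middle i = subst₂ _<_ (sym (Fin.toℕ-↑ˡ i (suc m))) (sym (Fin.toℕ-↑ʳ m zero))
    (<-≤-trans (Fin.toℕ<n i) (m≤m+n m 0))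

  middle<right : ∀ i → middle Fin.< right i
  middle<right i = subst₂ _<_ (sym (Fin.toℕ-↑ʳ m zero)) (sym (Fin.toℕ-↑ʳ m (suc i)))
    (+-monoʳ-< m z<s)

  left≢right : ∀ i j → left i ≢ right j
  left≢right i j = Fin.<⇒≢ (Fin.<-trans (left<middle i) (middle<right j))

  -- Reads come in either order, so an unordered pair must determine `i` and `j`. It does, because
  -- in the mixed cases a left vertex would equal a right one.
  Joins-injective : ∀ {i j i′ j′ u v} → Joins (left i) (right j) u v →
                    Joins (left i′) (right j′) u v → i ≡ i′ × j ≡ j′
  Joins-injective (inj₁ (refl , refl)) (inj₁ (p , q)) =
    Fin.↑ˡ-injective (suc m) _ _ p , Fin.suc-injective (Fin.↑ʳ-injective m _ _ q)
  Joins-injective (inj₁ (refl , _)) (inj₂ (p , _)) = contradiction p (left≢right _ _)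
  Joins-injective (inj₂ (refl , _)) (inj₁ (p , _)) = contradiction (sym p) (left≢right _ _)
  Joins-injective (inj₂ (refl , refl)) (inj₂ (p , q)) =
    Fin.↑ˡ-injective (suc m) _ _ q , Fin.suc-injective (Fin.↑ʳ-injective m _ _ p)

-- Runs and the reads they must contain

module _ {𝒜 : Algorithm} where
  open Algorithm 𝒜

  queries : ∀ {n} {D : Digraph n} {s b t} → RunsTo 𝒜 D s b t → List (Fin n × Fin n)
  queries (halted _)               = []
  queries (computed _ run)         = queries run
  queries (answered {u} {v} _ run) = (u , v) ∷ queries run

  length-queries : ∀ {n} {D : Digraph n} {s b t} (run : RunsTo 𝒜 D s b t) →
                   length (queries run) ≤ t
  length-queries (halted _)       = z≤n
  length-queries (computed _ run) = m≤n⇒m≤1+n (length-queries run)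
  length-queries (answered _ run) = s≤s (length-queries run)

  -- The input influences the state only through the answers to reads, so the two runs stay in the
  -- same state until some answer differs.
  distinguished-or-same-run : ∀ {n} {D : Digraph n} (D′ : Digraph n) {s b t}
    (run : RunsTo 𝒜 D s b t) →
    Any (Distinguishes D D′) (queries run) ⊎ RunsTo 𝒜 D′ s b t
  distinguished-or-same-run D′ (halted eq) = inj₂ (halted eq)
  distinguished-or-same-run D′ (computed eq run) with distinguished-or-same-run D′ run
  ... | inj₁ found = inj₁ found
  ... | inj₂ run′  = inj₂ (computed eq run′)
  distinguished-or-same-run {D = D} D′ {b = b} (answered {u} {v} {next} {t} eq run)
    with arc D u v ≟ᵇ arc D′ u v
  ... | no  differ = inj₁ (here differ)
  ... | yes same with distinguished-or-same-run D′ run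
  ...   | inj₁ found = inj₁ (there found)
  ...   | inj₂ run′  =
    inj₂ (answered eq (subst (λ r → RunsTo 𝒜 D′ (next r) b t) same run′))

  output-unique : ∀ {n} {D : Digraph n} {s b b′ t t′} →
                  RunsTo 𝒜 D s b t → RunsTo 𝒜 D s b′ t′ → b ≡ b′
  output-unique (halted p) (halted q) with refl ← trans (sym p) q = refl
  output-unique (halted p) (computed q _) with () ← trans (sym p) q
  output-unique (halted p) (answered q _) with () ← trans (sym p) q
  output-unique (computed p _) (halted q) with () ← trans (sym p) q
  output-unique (computed p r) (computed q r′) with refl ← trans (sym p) q =
    output-unique r r′
  output-unique (computed p _) (answered q _) with () ← trans (sym p) q
  output-unique (answered p _) (halted q) with () ← trans (sym p) q
  output-unique (answered p _) (computed q _) with () ← trans (sym p) q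
  output-unique (answered p r) (answered q r′) with refl ← trans (sym p) q =
    output-unique r r′

  -- Without a distinguishing read the run would also output `true` on `D′`; by determinism this is
  -- the answer whose correctness is assumed, which contradicts the no-instance.
  correct-run-distinguishes : ∀ {n} {D D′ : Digraph n} {ℓ k t} → DCOC D ℓ k → ¬ DCOC D′ ℓ k →
    CorrectOn 𝒜 D′ ℓ k → (run : Outputs 𝒜 D ℓ k true t) →
    Any (Distinguishes D D′) (queries run)
  correct-run-distinguishes {D′ = D′} yes-D no-D′ (b , _ , run′ , correct) run
    with distinguished-or-same-run D′ run
  ... | inj₁ found = found
  ... | inj₂ same  = contradiction (to correct (output-unique run′ same)) no-D′

  -- Each pair `i`, `j` is sent to the position of a read that detects the reversal of its arc. One
  -- read detects only one such reversal, so this map is injective into a list of length at most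
  -- `t`.
  m²≤time : ∀ m {t} → let D = transitive (m + suc m) in
            (∀ a b → CorrectOn 𝒜 (reverse D a b) 1 0) → Outputs 𝒜 D 1 0 true t → m * m ≤ t
  m²≤time m correct run = ≤-trans (Fin.injective⇒≤ {f = position} position-injective)
                                (length-queries run)
    where
    D = transitive (m + suc m)

    found : ∀ i j → Any (Distinguishes D (reverse D (left i) (right j))) (queries run)
    found i j = correct-run-distinguishes
      (acyclic⇒DCOC {D = D} (middle {m}) (transitive-acyclic (m + suc m)))
      (reverse-transitive-¬DCOC (left<middle i) (middle<right j))
      (correct (left i) (right j)) run

    position : Fin (m * m) → Fin (length (queries run))
    position k = let i , j = remQuot m k in Any.index (found i j)

    joined : ∀ k → let i , j = remQuot {m} m k
                       u , v = lookup (queries run) (position k)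
                   in Joins (left i) (right j) u v
    joined k = reverse-differs D (lookup-index (let i , j = remQuot {m} m k in found i j))

    position-injective : ∀ {k l} → position k ≡ position l → k ≡ l
    position-injective {k} {l} eq =
      let p , q = Joins-injective (joined k)
            -- Once the positions are identified, the same read joins the endpoints for `k` and
            -- those for `l`.
            (subst (λ x → let i , j = remQuot {m} m l
                              u , v = lookup (queries run) x
                          in Joins (left i) (right j) u v) (sym eq) (joined l))
      in trans (sym (Fin.combine-remQuot {m} m k))
               (trans (cong₂ combine p q) (Fin.combine-remQuot {m} m l))

-- The quadratic bound against little-o

[2k+3]²<10[k+1]² : ∀ k → (suc k + suc (suc k)) ^ 2 < 10 * (suc k * suc k)
[2k+3]²<10[k+1]² k = subst ((suc k + suc (suc k)) ^ 2 <_) (expand k) (m<m+n _ z<s)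
  where
  -- The last summand on the left is the positive gap between the two sides; the factor `1` comes
  -- from unfolding `^ 2`.
  expand : ∀ k → (suc k + suc (suc k)) * ((suc k + suc (suc k)) * 1) + suc (6 * (k * k) + 8 * k)
               ≡ 10 * (suc k * suc k)
  expand = solve-∀

theorem4p2 : ¬ (Σ[ 𝒜 ∈ Algorithm ]
    (∀ n (D : Digraph n) ℓ → Tournament D → Admissible n ℓ 0 →
    CorrectOn 𝒜 D ℓ 0)
    × (Σ[ f ∈ (ℕ → ℕ) ]
    f ∈o (λ n → n ^ 2)
    × (∀ n (D : Digraph n) ℓ → Tournament D → Admissible n ℓ 0 →
    TimeAtMost 𝒜 (f n) D ℓ 0)))
theorem4p2 (𝒜 , correct , f , f∈o , time) = <⇒≱ ([2k+3]²<10[k+1]² n₀) 10m²≤n²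
  where
  -- With `n` equal to 2m + 1, the ratio of `n ^ 2` to `m * m` tends to 4 and is at most 9 for
  -- positive `m`. Hence 10 works at once, and the successor in `m` keeps `m` positive and `n` above
  -- `n₀`.
  n₀ = proj₁ (f∈o 10)
  m  = suc n₀
  n  = m + suc m
  D  = transitive n
  admissible : Admissible n 1 0
  admissible = s≤s z≤n , s≤s (≤-trans (s≤s z≤n) (m≤n+m (suc m) n₀))

  run : ∃[ t ] Outputs 𝒜 D 1 0 true t
  -- Correctness only provides some output `b`; acyclicity makes this a yes-instance, which forces
  -- `b` to be `true`.
  run with b , t , run , b⇔ ← correct n D 1 (transitive-tournament n) admissible
    with refl ← from b⇔ (acyclic⇒DCOC {D = D} zero (transitive-acyclic n)) = t , run

  10m²≤n² : 10 * (m * m) ≤ n ^ 2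
  10m²≤n² = begin
    10 * (m * m)     ≤⟨ *-monoʳ-≤ 10 (m²≤time m correct-reverse (proj₂ run)) ⟩
    10 * proj₁ run   ≤⟨ *-monoʳ-≤ 10 (time n D 1 (transitive-tournament n) admissible
                                       true _ (proj₂ run)) ⟩
    10 * f n         ≤⟨ proj₂ (f∈o 10) n (m≤n⇒m≤1+n (m≤m+n n₀ (suc m))) ⟩
    n ^ 2            ∎
    where
    open ≤-Reasoning
    correct-reverse : ∀ a b → CorrectOn 𝒜 (reverse D a b) 1 0
    correct-reverse a b = correct n (reverse D a b) 1
      (reverse-tournament {D = D} (transitive-tournament n) a b) admissible
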